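{- There are infinitely many odd strongly pseudoperfect numbers.
   Context: A positive integer $n$ is strongly pseudoperfect if there is a subset $S$ of the positive divisors of $n$ (with $1$ and $n$ themselves allowed) such that $d\in S$ if and only if $n/d\in S$ for every positive divisor $d$ of $n$, and $\sum_{d\in S} d = 2n$. -}

module Defs where

open import Data.List.Base using (List; sum)
open import Data.List.Membership.Propositional using (_∈_)
open import Data.List.Relation.Unary.All using (All)
open import Data.List.Relation.Unary.Unique.Propositional using (Unique)
open import Data.Nat.Base using (ℕ; NonZero; _*_; _/_)
open import Data.Nat.Divisibility using (_∣_)
open import Function.Bundles using (_⇔_)
open import Relation.Binary.PropositionalEquality.Core using (_≡_)

-- The set S of divisors is a duplicate-free list, so that `sum S` counts
-- each element exactly once.
record StronglyPseudoperfect (n : ℕ) : Set where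
  field
    positive  : NonZero n
    S         : List ℕ
    unique    : Unique S
    divisors  : All (_∣ n) S
    symmetric : ∀ d .{{_ : NonZero d}} → d ∣ n → (d ∈ S) ⇔ (n / d ∈ S)
    sum≡2n    : sum S ≡ 2 * n

{-# OPTIONS --safe #-}
module Submission where

open import Defs
open import Data.Nat.Base using (ℕ; _<_)
open import Data.Nat.Divisibility using (_∤_)
open import Data.Product.Base using (∃-syntax; _×_)

open import Data.List.Base using (List; []; _∷_; _++_; map)
open import Data.List.Membership.Propositional using (_∈_; find; lose)
open import Data.List.Membership.Propositional.Properties
  using (∈-++⁺ˡ; ∈-++⁺ʳ; ∈-map⁺; ∈-map⁻)
open import Data.List.Relation.Unary.All as All using (All; all?)
import Data.List.Relation.Unary.All.Properties as All
open import Data.List.Relation.Unary.Any using (Any; any?)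
open import Data.List.Relation.Unary.Unique.Propositional using (Unique)
import Data.List.Relation.Unary.Unique.Propositional.Properties as Unique
open import Data.Nat.Base using (NonZero; zero; suc; _+_; _*_; _^_; _/_; z<s; s<s)
open import Data.Nat.Divisibility using (_∣_; divides; m∣m*n; _∣?_; ∣1⇒≡1)
open import Data.Nat.DivMod using (m*n/n≡m; m/n*n≡m; /-congˡ)
open import Data.Nat.ListAction using (sum)
open import Data.Nat.ListAction.Properties using (sum-++)
open import Data.Nat.Primality using (Prime; prime[2]; euclidsLemma; ¬prime[1])
open import Data.Nat.Properties
open import Data.Nat.Tactic.RingSolver using (solve-∀)
open import Data.Product.Base using (_,_)
open import Data.Sum.Base using ([_,_])
open import Function.Bundles using (mk⇔)
open import Relation.Binary.PropositionalEquality hiding ([_])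
open import Relation.Nullary.Decidable using (from-yes; ¬?)

open import Data.List.Relation.Unary.Unique.DecPropositional _≟_ using (unique?)

-- The construction inserts arbitrarily many copies of one fixed layer.  Call
-- lists xs, ys n-complementary if d ↦ n / d maps xs into ys.  Take a list A
-- that is m-complementary to itself and lists B, H that are m-complementary to
-- each other, A and B having no multiple of p.  Then
--   B ∪ p A ∪ p² A ∪ … ∪ p^L A ∪ p^(L+1) H
-- is a disjoint union, is complementary to itself for n = m p^(L+1), and, if
-- sum B = p c, sum A = (p - 1) c and sum H = 2 m - c, its sum telescopes to 2 n.
-- For m = 945, p = 273, c = 1 such lists exist.

Complementary : ℕ → List ℕ → List ℕ → Set
Complementary n xs ys = All (λ x → Any (λ y → x * y ≡ n) ys) xs

selfComplementary⇒stronglyPseudoperfect :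
  ∀ {n xs} → NonZero n → Unique xs → Complementary n xs xs →
  sum xs ≡ 2 * n → StronglyPseudoperfect n
selfComplementary⇒stronglyPseudoperfect {n} {xs} n≢0 xs! comp sum≡ = record
  { positive  = n≢0
  ; S         = xs
  ; unique    = xs!
  ; divisors  = All.map (λ any → let y , _ , xy≡n = find any in
                          divides y (trans (sym xy≡n) (*-comm _ y))) comp
  ; symmetric = λ d d∣n → mk⇔ (to d) (from d d∣n)
  ; sum≡2n    = sum≡
  }
  where
  to : ∀ d .{{_ : NonZero d}} → d ∈ xs → n / d ∈ xs
  to d d∈xs with y , y∈xs , refl ← find (All.lookup comp d∈xs) =
    subst (_∈ xs) (sym (trans (/-congˡ (*-comm d y)) (m*n/n≡m y d))) y∈xs

  from : ∀ d .{{_ : NonZero d}} → d ∣ n → n / d ∈ xs → d ∈ xs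
  from d d∣n n/d∈xs with y , y∈xs , eq ← find (All.lookup comp n/d∈xs) =
    -- Both `y` and `d` multiply `n / d` to `n`, so cancelling `n / d` gives `y ≡ d`.
    subst (_∈ xs) (*-cancelˡ-≡ y d (n / d) {{n/d≢0}} (trans eq (sym (m/n*n≡m d∣n)))) y∈xs
    where
    n/d≢0 : NonZero (n / d)
    n/d≢0 = m*n≢0⇒m≢0 (n / d) {{subst NonZero (sym (m/n*n≡m d∣n)) n≢0}}

sum-map-* : ∀ k xs → sum (map (k *_) xs) ≡ k * sum xs
sum-map-* k []       = sym (*-zeroʳ k)
sum-map-* k (x ∷ xs) = trans (cong (k * x +_) (sum-map-* k xs)) (sym (*-distribˡ-+ k x (sum xs)))

++-map-*-unique : ∀ k .{{_ : NonZero k}} {xs ys} → All (k ∤_) xs →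
                  Unique xs → Unique ys → Unique (xs ++ map (k *_) ys)
++-map-*-unique k k∤xs xs! ys! =
  Unique.++⁺ xs! (Unique.map⁺ (*-cancelˡ-≡ _ _ k) ys!) λ (v∈xs , v∈kys) →
    let y , _ , v≡ky = ∈-map⁻ (k *_) v∈kys in
    All.lookup k∤xs v∈xs (subst (k ∣_) (sym v≡ky) (m∣m*n y))

private
  shift : ∀ a p q b → a * (p * (q * b)) ≡ a * b * (p * q)
  shift = solve-∀

  swap : ∀ p m q → p * (m * q) ≡ m * (p * q)
  swap = solve-∀

module Layers
  {m p c : ℕ} {{m≢0 : NonZero m}} {{p≢0 : NonZero p}} {A B H : List ℕ}
  (A! : Unique A) (B! : Unique B) (H! : Unique H)
  (p∤A : All (p ∤_) A) (p∤B : All (p ∤_) B)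
  (A~A : Complementary m A A) (B~H : Complementary m B H) (H~B : Complementary m H B)
  -- Adding `c` on the left avoids truncated subtraction in (p - 1) c and 2 m - c.
  (sum-A : c + sum A ≡ p * c) (sum-B : sum B ≡ p * c) (sum-H : c + sum H ≡ 2 * m)
  where

  -- Everything above the bottom layer `B`, with one factor `p` taken out: A ∪ p A ∪ ... ∪ p^(L-1) A
  -- ∪ p^L H.
  upper : ℕ → List ℕ
  upper zero    = H
  upper (suc L) = A ++ map (p *_) (upper L)

  layers : ℕ → List ℕ
  layers L = B ++ map (p *_) (upper L)

  upper-unique : ∀ L → Unique (upper L)
  upper-unique zero    = H!
  upper-unique (suc L) = ++-map-*-unique p p∤A A! (upper-unique L)

  layers-unique : ∀ L → Unique (layers L)
  layers-unique L = ++-map-*-unique p p∤B B! (upper-unique L)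

  -- The term `c` is what telescopes: a new layer `A` turns it into `p * c`, and then `p` factors
  -- out of the whole sum.
  upper-sum : ∀ L → c + sum (upper L) ≡ 2 * (m * p ^ L)
  upper-sum zero    = trans sum-H (cong (2 *_) (sym (*-identityʳ m)))
  upper-sum (suc L) = begin
    c + sum (A ++ map (p *_) (upper L))       ≡⟨ cong (c +_) (sum-++ A _) ⟩
    c + (sum A + sum (map (p *_) (upper L)))  ≡⟨ +-assoc c (sum A) _ ⟨
    c + sum A + sum (map (p *_) (upper L))    ≡⟨ cong₂ _+_ sum-A (sum-map-* p (upper L)) ⟩
    p * c + p * sum (upper L)                 ≡⟨ *-distribˡ-+ p c _ ⟨
    p * (c + sum (upper L))                   ≡⟨ cong (p *_) (upper-sum L) ⟩
    p * (2 * (m * p ^ L))                     ≡⟨ double p m (p ^ L) ⟩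
    2 * (m * p ^ suc L)                       ∎
    where
    open ≡-Reasoning
    double : ∀ p m q → p * (2 * (m * q)) ≡ 2 * (m * (p * q))
    double = solve-∀

  layers-sum : ∀ L → sum (layers L) ≡ 2 * (m * p ^ suc L)
  layers-sum L = begin
    sum (B ++ map (p *_) (upper L))           ≡⟨ sum-++ B _ ⟩
    -- `B` weighs as much as `c` and `A` together, which reduces the sum to that of `upper (suc L)`.
    sum B + sum (map (p *_) (upper L))        ≡⟨ cong (_+ sum (map (p *_) (upper L))) (trans sum-B (sym sum-A)) ⟩
    c + sum A + sum (map (p *_) (upper L))    ≡⟨ +-assoc c (sum A) _ ⟩
    c + (sum A + sum (map (p *_) (upper L)))  ≡⟨ cong (c +_) (sum-++ A _) ⟨
    c + sum (upper (suc L))                   ≡⟨ upper-sum (suc L) ⟩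
    2 * (m * p ^ suc L)                       ∎
    where open ≡-Reasoning

  H⇒upper : ∀ L {h} → h ∈ H → p ^ L * h ∈ upper L
  H⇒upper zero    {h} h∈H = subst (_∈ H) (sym (*-identityˡ h)) h∈H
  H⇒upper (suc L) {h} h∈H = ∈-++⁺ʳ A
    (subst (_∈ map (p *_) (upper L)) (sym (*-assoc p (p ^ L) h)) (∈-map⁺ (p *_) (H⇒upper L h∈H)))

  -- The index `i + suc j` says that layer `i` lies strictly below the top one, which is built from
  -- `H` instead of `A`.
  A⇒upper : ∀ i j {a} → a ∈ A → p ^ i * a ∈ upper (i + suc j)
  A⇒upper zero    j {a} a∈A = ∈-++⁺ˡ (subst (_∈ A) (sym (*-identityˡ a)) a∈A)
  A⇒upper (suc i) j {a} a∈A = ∈-++⁺ʳ A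
    (subst (_∈ map (p *_) (upper (i + suc j))) (sym (*-assoc p (p ^ i) a))
      (∈-map⁺ (p *_) (A⇒upper i j a∈A)))

  upper⇒layers : ∀ L {x} → x ∈ upper L → p * x ∈ layers L
  upper⇒layers L x∈ = ∈-++⁺ʳ B (∈-map⁺ (p *_) x∈)

  -- The complement of an element of upper L lies in p^i A with i ≤ L, or in B,
  -- and never in the top layer.  Hence it belongs to layers (L + K) for every K,
  -- the generality that the induction on L needs.
  upper~layers : ∀ L K → Complementary (m * p ^ L) (upper L) (layers (L + K))
  upper~layers zero    K = All.map (λ any → let b , b∈B , hb≡m = find any in
    lose (∈-++⁺ˡ b∈B) (trans hb≡m (sym (*-identityʳ m)))) H~B
  upper~layers (suc L) K = All.++⁺
    (All.map (λ {a} any → let a′ , a′∈A , aa′≡m = find any in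
      lose (upper⇒layers (suc L + K)
             (subst (λ k → p ^ L * a′ ∈ upper k) (+-suc L K) (A⇒upper L K a′∈A)))
           (trans (shift a p (p ^ L) a′) (cong (_* p ^ suc L) aa′≡m)))
      A~A)
    -- Scaling `x` by `p` scales the product by `p`, so the partner `e` is kept; as `L` drops by
    -- one, `K` rises by one.
    (All.map⁺ (All.map (λ {x} any → let e , e∈ , xe≡ = find any in
      lose (subst (λ k → e ∈ layers k) (+-suc L K) e∈)
           (trans (*-assoc p x e) (trans (cong (p *_) xe≡) (swap p m (p ^ L)))))
      (upper~layers L (suc K))))

  -- The bottom layer `B` pairs with the top layer p^(L+1) H; all other entries are covered by
  -- `upper~layers` at `K = 0`.
  layers~layers : ∀ L → Complementary (m * p ^ suc L) (layers L) (layers L)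
  layers~layers L = All.++⁺
    (All.map (λ {b} any → let h , h∈H , bh≡m = find any in
      lose (upper⇒layers L (H⇒upper L h∈H))
           (trans (shift b p (p ^ L) h) (cong (_* p ^ suc L) bh≡m)))
      B~H)
    (All.map⁺ (All.map (λ {x} any → let e , e∈ , xe≡ = find any in
      lose (subst (λ k → e ∈ layers k) (+-identityʳ L) e∈)
           (trans (*-assoc p x e) (trans (cong (p *_) xe≡) (swap p m (p ^ L)))))
      (upper~layers L 0)))

  stronglyPseudoperfect : ∀ L → StronglyPseudoperfect (m * p ^ suc L)
  stronglyPseudoperfect L = selfComplementary⇒stronglyPseudoperfect
    (m*n≢0 m (p ^ suc L) {{m≢0}} {{m^n≢0 p (suc L)}})
    (layers-unique L) (layers~layers L) (layers-sum L)

945*273^[1+_]-stronglyPseudoperfect : ∀ L → StronglyPseudoperfect (945 * 273 ^ suc L)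
945*273^[1+_]-stronglyPseudoperfect = Layers.stronglyPseudoperfect {945} {273} {1} {A = A} {B} {H}
  (from-yes (unique? A)) (from-yes (unique? B)) (from-yes (unique? H))
  (from-yes (all? (λ x → ¬? (273 ∣? x)) A)) (from-yes (all? (λ x → ¬? (273 ∣? x)) B))
  (from-yes (complementary? A A)) (from-yes (complementary? B H)) (from-yes (complementary? H B))
  refl refl refl
  where
  A B H : List ℕ
  -- `A` consists of the pairs 5 · 189 = 15 · 63 = 945, and `H` lists 945 / b for b in `B`, in the
  -- same order. The sums are 272, 273 and 1889 = 2 · 945 - 1. All entries of `A` and `B` are
  -- positive and below 273, hence not multiples of it.
  A = 5 ∷ 15 ∷ 63 ∷ 189 ∷ []
  B = 1 ∷ 3 ∷ 5 ∷ 7 ∷ 9 ∷ 15 ∷ 21 ∷ 27 ∷ 35 ∷ 45 ∷ 105 ∷ []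
  H = 945 ∷ 315 ∷ 189 ∷ 135 ∷ 105 ∷ 63 ∷ 45 ∷ 35 ∷ 27 ∷ 21 ∷ 9 ∷ []

  complementary? = λ xs ys → all? (λ x → any? (λ y → x * y ≟ 945) ys) xs

prime∤* : ∀ {q m n} → Prime q → q ∤ m → q ∤ n → q ∤ m * n
prime∤* {m = m} {n} q-prime q∤m q∤n q∣mn = [ q∤m , q∤n ] (euclidsLemma m n q-prime q∣mn)

prime∤^ : ∀ {q m} → Prime q → q ∤ m → ∀ k → q ∤ m ^ k
prime∤^ q-prime q∤m zero    q∣1 = ¬prime[1] (subst Prime (∣1⇒≡1 q∣1) q-prime)
prime∤^ q-prime q∤m (suc k) = prime∤* q-prime q∤m (prime∤^ q-prime q∤m k)

n<m^n : ∀ {m} → 1 < m → ∀ n → n < m ^ n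
n<m^n         1<m zero    = z<s
n<m^n {m} 1<m (suc n) =
  <-≤-trans (s<s (n<m^n 1<m n)) (^-monoʳ-< m 1<m (n<1+n n))

corollary7 : ∀ (N : ℕ) → ∃[ n ] (N < n × 2 ∤ n × StronglyPseudoperfect n)
corollary7 N =
  -- The power of 273 alone exceeds `N`, and 945 and 273 are both odd.
  945 * 273 ^ suc N ,
  <-≤-trans (<-trans (n<1+n N) (n<m^n (from-yes (1 <? 273)) (suc N))) (m≤n*m (273 ^ suc N) 945) ,
  prime∤* prime[2] (from-yes (¬? (2 ∣? 945))) (prime∤^ prime[2] (from-yes (¬? (2 ∣? 273))) (suc N)) ,
  945*273^[1+ N ]-stronglyPseudoperfect
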